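{- Let $M$ be a matrix with entries in $\{0,1,2,3\}$ that contains a cycle of length at least $6$. Then $M$ contains a $2\times 2$, $2\times 3$, or $3\times 2$ submatrix that is not a weak lonesum matrix (as a $4$-ary matrix).
   Context: A $q$-ary matrix has entries in $\{0,1,\ldots,q-1\}$. The structure vector of a $q$-ary vector $v=(v_1,\ldots,v_n)$ is $(a_0,\ldots,a_{q-1})$ where $a_t$ is the number of indices $i$ with $v_i=t$. A $q$-ary matrix $N$ is a weak lonesum matrix if it is the only $q$-ary matrix of its size having the same structure vector as $N$ in every row and every column. A submatrix is obtained by selecting some rows and some columns. A path in $M$ is a sequence $(M_{i_1,j_1},\ldots,M_{i_k,j_k})$ of entries at mutually distinct positions such that: (1) for each $1\le l\le k-1$, $i_l=i_{l+1}$ or $j_l=j_{l+1}$; (2) for each $1\le l\le k-2$, $|\{i_l,i_{l+1},i_{l+2}\}|\ge 2$ and $|\{j_l,j_{l+1},j_{l+2}\}|\ge 2$; (3) there are two distinct values $a,b$ such that the sequence of values is $(a,b,a,b,\ldots)$ (alternating, ending in either $a$ or $b$). Such a path is a cycle if, setting $(i_{k+1},j_{k+1})=(i_1,j_1)$ and $(i_{k+2},j_{k+2})=(i_2,j_2)$, the extended sequence $(M_{i_1,j_1},\ldots,M_{i_{k+2},j_{k+2}})$ also satisfies conditions (1)–(3); its length is $k$. -}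

module Defs where

open import Data.Nat using (ℕ; zero; suc; _+_; _<_; _%_)
open import Data.Fin using (Fin; _≟_) renaming (_<_ to _<ᶠ_)
open import Data.List using (List; length; filter; allFin)
open import Data.Product using (_×_; Σ; ∃; proj₁; proj₂; _,_)
open import Data.Sum using (_⊎_)
open import Relation.Binary.PropositionalEquality using (_≡_; _≢_)
open import Relation.Nullary using (¬_)

Matrix : ℕ → ℕ → ℕ → Set
Matrix q r c = Fin r → Fin c → Fin q

rowStruct : ∀ {q r c} → Matrix q r c → Fin r → Fin q → ℕ
rowStruct {c = c} N i t = length (filter (λ j → N i j ≟ t) (allFin c))

colStruct : ∀ {q r c} → Matrix q r c → Fin c → Fin q → ℕ
colStruct {r = r} N j t = length (filter (λ i → N i j ≟ t) (allFin r))

WeakLonesum : ∀ {q r c} → Matrix q r c → Set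
WeakLonesum {q} {r} {c} N =
  (N' : Matrix q r c) →
  (∀ i t → rowStruct N' i t ≡ rowStruct N i t) →
  (∀ j t → colStruct N' j t ≡ colStruct N j t) →
  ∀ i j → N' i j ≡ N i j

StrictlyIncreasing : ∀ {a b} → (Fin a → Fin b) → Set
StrictlyIncreasing f = ∀ i j → i <ᶠ j → f i <ᶠ f j

submatrix : ∀ {q m n r c} → Matrix q m n → (Fin r → Fin m) → (Fin c → Fin n) → Matrix q r c
submatrix M f g i j = M (f i) (g j)

-- Positions and sequences of positions; a sequence of length K is a
-- function ℕ → position of which only indices 0 … K-1 are relevant.
Pos : ℕ → ℕ → Set
Pos m n = Fin m × Fin n

row : ∀ {m n} → Pos m n → Fin m
row = proj₁

col : ∀ {m n} → Pos m n → Fin n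
col = proj₂

PathConds : ∀ {q m n} → Matrix q m n → (K : ℕ) → (ℕ → Pos m n) → Set
PathConds {q} M K s =
  (∀ l → suc l < K → row (s l) ≡ row (s (suc l)) ⊎ col (s l) ≡ col (s (suc l))) ×
  (∀ l → suc (suc l) < K →
     ¬ (row (s l) ≡ row (s (suc l)) × row (s (suc l)) ≡ row (s (suc (suc l)))) ×
     ¬ (col (s l) ≡ col (s (suc l)) × col (s (suc l)) ≡ col (s (suc (suc l))))) ×
  (Σ (Fin q) λ a → Σ (Fin q) λ b → a ≢ b ×
     (∀ l → l < K → M (row (s l)) (col (s l)) ≡ (if0 (l % 2) a b)))
  where
  if0 : ℕ → Fin q → Fin q → Fin q
  if0 zero a b = a
  if0 (suc _) a b = b

Path : ∀ {q m n} → Matrix q m n → (K : ℕ) → (ℕ → Pos m n) → Set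
Path M K s = (∀ i j → i < K → j < K → s i ≡ s j → i ≡ j) × PathConds M K s

-- Cyclic extension: index l ↦ s (l mod K), so the (K+1)-st and (K+2)-nd
-- entries are the 1st and 2nd.
cyc : ∀ {A : Set} → ℕ → (ℕ → A) → ℕ → A
cyc zero s = s
cyc (suc k) s l = s (l % suc k)

Cycle : ∀ {q m n} → Matrix q m n → (K : ℕ) → (ℕ → Pos m n) → Set
Cycle M K s = Path M K s × PathConds M (K + 2) (cyc K s)

HasNonWLSubmatrix : ∀ {q m n} → Matrix q m n → ℕ → ℕ → Set
HasNonWLSubmatrix {m = m} {n} M r c =
  Σ (Fin r → Fin m) λ f → Σ (Fin c → Fin n) λ g →
    StrictlyIncreasing f × StrictlyIncreasing g × ¬ WeakLonesum (submatrix M f g)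

{-# OPTIONS --safe #-}
-- Suppose M has no pattern of the following kind: in two rows, a directed 2-cycle or 3-cycle among
-- the arrows that each column draws between its two colours; and likewise for two columns.
-- Along a cycle coloured a, b the turns give rows r i and columns c i with entries a at
-- (r i , c i) and b at (r i , c (i + 1)); take such a closed walk of least period k. An a or b at
-- any other (r i , c j) would shorten it, so these entries carry just the two remaining colours.
-- The forbidden patterns then make the entries at distance j − i = 2 constant, the entries at
-- distance k − 1 different from them, and (r i , c j) equal to (r (i + 1) , c (j − 1)) for
-- j − i ≥ 4. Sliding an even distance down to 2 gives a contradiction: start from k − 1 if k is
-- odd, and from k − 2 if k is even, since (r i , c j) and (r j , c i) must differ.
module Submission where

open import Defs
open import Data.Nat using (ℕ; _≤_)
open import Data.Sum using (_⊎_)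

open import Data.Empty using (⊥; ⊥-elim)
open import Data.Fin using (Fin; zero; suc; _≟_) renaming (_<_ to _<ᶠ_)
open import Data.Fin.Properties as Fin using (any?; pigeonhole; <-cmp)
open import Data.List using ([]; _∷_; length; filter; allFin; map)
open import Data.List.Relation.Binary.Permutation.Propositional using (_↭_; ↭-sym)
open import Data.List.Relation.Binary.Permutation.Propositional.Properties
  using (↭-length; filter-↭; ++-comm)
open import Data.Nat using (zero; suc; _+_; _*_; _<_; _%_; z≤n; s≤s; z<s; NonZero)
open import Data.Nat.DivMod
  using (m%n<n; m<n⇒m%n≡m; n%n≡0; m*n%n≡0; [m+kn]%n≡m%n; [m+n]%n≡m%n; %-distribˡ-+; m%n%n≡m%n)
open import Data.Nat.Induction using (<-rec)
open import Data.Nat.Properties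
  using (≤-refl; ≤-trans; ≤-reflexive; <⇒≤; n<1+n; n≤1+n; m≤n⇒m≤1+n; m≤n+m; m≤m+n;
         m≤n⇒m<n∨m≡n; m≤n⇒∃[o]m+o≡n; *-monoˡ-≤; +-comm; +-suc)
open import Data.Nat.Tactic.RingSolver using (solve-∀)
open import Data.Product as Product using (∃; _×_; _,_; proj₁; proj₂)
open import Data.Sum as Sum using (inj₁; inj₂; [_,_]′)
open import Data.Vec as Vec using (Vec; []; _∷_)
open import Data.Vec.Relation.Unary.All using ([]; _∷_)
open import Data.Vec.Relation.Unary.AllPairs using ([]; _∷_)
open import Data.Vec.Relation.Unary.Unique.Propositional.Properties using (lookup-injective)
open import Function using (flip; _∘_; case_of_)
open import Relation.Binary.Definitions using (tri<; tri≈; tri>)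
open import Relation.Binary.PropositionalEquality
  using (_≡_; _≢_; refl; sym; trans; cong; cong₂; subst; ≢-sym)
open import Relation.Nullary using (¬_; Dec; yes; no)
open import Relation.Nullary.Decidable using (_×-dec_; _⊎-dec_; ¬?; decidable-stable)
open import Relation.Unary using (Pred; Decidable)

private
  variable
    m n q : ℕ

-- Matrices that are not weak lonesum

module _ {A : Set} where

  length-filter-map : ∀ {B : Set} {p} {P : Pred B p} (P? : Decidable P) (f : A → B) xs →
                      length (filter P? (map f xs)) ≡ length (filter (P? ∘ f) xs)
  length-filter-map P? f []       = refl
  length-filter-map P? f (x ∷ xs) with P? (f x)
  ... | yes _ = cong suc (length-filter-map P? f xs)
  ... | no  _ = length-filter-map P? f xs

  count-cong-↭ : ∀ {f g : A → Fin q} xs → map f xs ↭ map g xs → ∀ t →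
                 length (filter (λ x → f x ≟ t) xs) ≡ length (filter (λ x → g x ≟ t) xs)
  count-cong-↭ {f = f} {g} xs f↭g t =
    trans (sym (length-filter-map (_≟ t) f xs))
      (trans (↭-length (filter-↭ (_≟ t) f↭g)) (length-filter-map (_≟ t) g xs))

-- Exchanging the two rows preserves all structure vectors.
rows-↭⇒¬WeakLonesum : ∀ {c} (N : Matrix q 2 c) →
  map (N zero) (allFin c) ↭ map (N (suc zero)) (allFin c) →
  ∀ j → N zero j ≢ N (suc zero) j → ¬ WeakLonesum N
rows-↭⇒¬WeakLonesum {q} {c} N rows↭ j N₀≢N₁ weakLonesum =
  N₀≢N₁ (sym (weakLonesum N′ rows cols zero j))
  where
  N′ : Matrix q 2 c
  N′ zero       = N (suc zero)
  N′ (suc zero) = N zero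

  rows : ∀ i t → rowStruct N′ i t ≡ rowStruct N i t
  rows zero       = count-cong-↭ (allFin c) (↭-sym rows↭)
  rows (suc zero) = count-cong-↭ (allFin c) rows↭

  cols : ∀ j t → colStruct N′ j t ≡ colStruct N j t
  cols j =
    count-cong-↭ {f = λ i → N′ i j} {λ i → N i j} (allFin 2) (++-comm (N (suc zero) j ∷ []) (N zero j ∷ []))

[-]-increasing : ∀ (x : Fin n) → StrictlyIncreasing (Vec.lookup (x ∷ []))
[-]-increasing x zero zero ()

∷-increasing : ∀ {k} {x y : Fin n} {ys : Vec (Fin n) k} → x <ᶠ y →
  StrictlyIncreasing (Vec.lookup (y ∷ ys)) → StrictlyIncreasing (Vec.lookup (x ∷ y ∷ ys))
∷-increasing x<y ys↑ zero    (suc zero)    _         = x<y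
∷-increasing x<y ys↑ zero    (suc (suc j)) _         = Fin.<-trans x<y (ys↑ zero (suc j) z<s)
∷-increasing x<y ys↑ (suc i) (suc j)       (s≤s i<j) = ys↑ i j i<j

-- Under `flip`, row and column structure vectors trade places definitionally.
HasNonWLSubmatrix-transpose : ∀ {M : Matrix q m n} {r c} →
  HasNonWLSubmatrix (flip M) r c → HasNonWLSubmatrix M c r
HasNonWLSubmatrix-transpose (f , g , f↑ , g↑ , ¬wl) =
  g , f , g↑ , f↑ , λ wl → ¬wl λ N′ rows cols i j → wl (flip N′) cols rows j i

-- Reading columns as arrows from the colour in row i to the colour in row i′,
-- exchanges are directed 2-cycles and rotations are directed 3-cycles.
IsExchange : Matrix q m n → (i i′ : Fin m) (j j′ : Fin n) → Set
IsExchange M i i′ j j′ = M i j ≡ M i′ j′ × M i j′ ≡ M i′ j × M i j ≢ M i j′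

IsRotation : Matrix q m n → (i i′ : Fin m) (j₀ j₁ j₂ : Fin n) → Set
IsRotation M i i′ j₀ j₁ j₂ =
  M i′ j₀ ≡ M i j₁ × M i′ j₁ ≡ M i j₂ × M i′ j₂ ≡ M i j₀ ×
  M i j₀ ≢ M i j₁ × M i j₁ ≢ M i j₂ × M i j₂ ≢ M i j₀

Exchange : Matrix q m n → Set
Exchange M = ∃ λ i → ∃ λ i′ → ∃ λ j → ∃ λ j′ → IsExchange M i i′ j j′

Rotation : Matrix q m n → Set
Rotation M = ∃ λ i → ∃ λ i′ → ∃ λ j₀ → ∃ λ j₁ → ∃ λ j₂ → IsRotation M i i′ j₀ j₁ j₂

module _ (M : Matrix q m n) where

  exchange-rows : ∀ {i i′ j j′} → IsExchange M i i′ j j′ → IsExchange M i′ i j j′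
  exchange-rows (e , e′ , ne) = sym e′ , sym e , λ eq → ne (trans e (trans (sym eq) (sym e′)))

  exchange-cols : ∀ {i i′ j j′} → IsExchange M i i′ j j′ → IsExchange M i i′ j′ j
  exchange-cols (e , e′ , ne) = e′ , e , ≢-sym ne

  rotate : ∀ {i i′ j₀ j₁ j₂} → IsRotation M i i′ j₀ j₁ j₂ → IsRotation M i i′ j₁ j₂ j₀
  rotate (e₀ , e₁ , e₂ , n₀ , n₁ , n₂) = e₁ , e₂ , e₀ , n₁ , n₂ , n₀

  -- Exchanging the two rows reverses every arrow, so the 3-cycle is traversed backwards.
  reflect : ∀ {i i′ j₀ j₁ j₂} → IsRotation M i i′ j₀ j₁ j₂ → IsRotation M i′ i j₀ j₂ j₁
  reflect (e₀ , e₁ , e₂ , n₀ , n₁ , n₂) =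
    sym e₂ , sym e₁ , sym e₀ ,
    (λ eq → n₀ (trans (sym e₂) (trans (sym eq) e₀))) ,
    (λ eq → n₂ (trans (sym e₁) (trans (sym eq) e₂))) ,
    (λ eq → n₁ (trans (sym e₀) (trans (sym eq) e₁)))

  sorted-exchange⇒nonWL : ∀ {i i′ j j′} → i <ᶠ i′ → j <ᶠ j′ → IsExchange M i i′ j j′ →
                          HasNonWLSubmatrix M 2 2
  sorted-exchange⇒nonWL {i} {i′} {j} {j′} i<i′ j<j′ (e , e′ , ne) =
    Vec.lookup (i ∷ i′ ∷ []) , Vec.lookup (j ∷ j′ ∷ []) ,
    ∷-increasing i<i′ ([-]-increasing i′) , ∷-increasing j<j′ ([-]-increasing j′) ,
    rows-↭⇒¬WeakLonesum _ rows↭ zero (λ eq → ne (trans eq (sym e′)))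
    where
    rows↭ : M i j ∷ M i j′ ∷ [] ↭ M i′ j ∷ M i′ j′ ∷ []
    rows↭ rewrite e | e′ = ++-comm (M i′ j′ ∷ []) (M i′ j ∷ [])

  ascending-rotation⇒nonWL : ∀ {i i′ j₀ j₁ j₂} → i <ᶠ i′ → j₀ <ᶠ j₁ → j₁ <ᶠ j₂ →
    IsRotation M i i′ j₀ j₁ j₂ → HasNonWLSubmatrix M 2 3
  ascending-rotation⇒nonWL {i} {i′} {j₀} {j₁} {j₂} i<i′ j₀<j₁ j₁<j₂ (e₀ , e₁ , e₂ , n₀ , _) =
    Vec.lookup (i ∷ i′ ∷ []) , Vec.lookup (j₀ ∷ j₁ ∷ j₂ ∷ []) ,
    ∷-increasing i<i′ ([-]-increasing i′) ,
    ∷-increasing j₀<j₁ (∷-increasing j₁<j₂ ([-]-increasing j₂)) ,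
    rows-↭⇒¬WeakLonesum _ rows↭ zero (λ eq → n₀ (trans eq e₀))
    where
    rows↭ : M i j₀ ∷ M i j₁ ∷ M i j₂ ∷ [] ↭ M i′ j₀ ∷ M i′ j₁ ∷ M i′ j₂ ∷ []
    -- In the colours of row `i`, row `i′` is row `i` shifted cyclically by one place.
    rows↭ rewrite e₀ | e₁ | e₂ = ++-comm (M i j₀ ∷ []) (M i j₁ ∷ M i j₂ ∷ [])

  descending-rotation⇒nonWL : ∀ {i i′ j₀ j₁ j₂} → i <ᶠ i′ → j₀ <ᶠ j₂ → j₂ <ᶠ j₁ →
    IsRotation M i i′ j₀ j₁ j₂ → HasNonWLSubmatrix M 2 3
  descending-rotation⇒nonWL {i} {i′} {j₀} {j₁} {j₂} i<i′ j₀<j₂ j₂<j₁ (e₀ , e₁ , e₂ , n₀ , _) =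
    Vec.lookup (i ∷ i′ ∷ []) , Vec.lookup (j₀ ∷ j₂ ∷ j₁ ∷ []) ,
    ∷-increasing i<i′ ([-]-increasing i′) ,
    ∷-increasing j₀<j₂ (∷-increasing j₂<j₁ ([-]-increasing j₁)) ,
    rows-↭⇒¬WeakLonesum _ rows↭ zero (λ eq → n₀ (trans eq e₀))
    where
    rows↭ : M i j₀ ∷ M i j₂ ∷ M i j₁ ∷ [] ↭ M i′ j₀ ∷ M i′ j₂ ∷ M i′ j₁ ∷ []
    rows↭ rewrite e₀ | e₁ | e₂ = ++-comm (M i j₀ ∷ M i j₂ ∷ []) (M i j₁ ∷ [])

  exchange⇒nonWL : Exchange M → HasNonWLSubmatrix M 2 2
  exchange⇒nonWL (i , i′ , j , j′ , ex@(e , e′ , ne)) with <-cmp i i′ | <-cmp j j′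
  ... | tri≈ _ refl _ | _             = ⊥-elim (ne e)
  ... | tri< _ _ _    | tri≈ _ refl _ = ⊥-elim (ne refl)
  ... | tri> _ _ _    | tri≈ _ refl _ = ⊥-elim (ne refl)
  ... | tri< i< _ _   | tri< j< _ _   = sorted-exchange⇒nonWL i< j< ex
  ... | tri< i< _ _   | tri> _ _ j>   = sorted-exchange⇒nonWL i< j> (exchange-cols ex)
  ... | tri> _ _ i>   | tri< j< _ _   = sorted-exchange⇒nonWL i> j< (exchange-rows ex)
  ... | tri> _ _ i>   | tri> _ _ j>   =
    sorted-exchange⇒nonWL i> j> (exchange-cols (exchange-rows ex))

  -- Up to `rotate`, three distinct columns have only two cyclic orders, ascending and descending.
  row-sorted-rotation⇒nonWL : ∀ {i i′ j₀ j₁ j₂} → i <ᶠ i′ → IsRotation M i i′ j₀ j₁ j₂ →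
                              HasNonWLSubmatrix M 2 3
  row-sorted-rotation⇒nonWL {j₀ = j₀} {j₁} {j₂} i< ro@(_ , _ , _ , n₀ , n₁ , n₂)
    with <-cmp j₀ j₁ | <-cmp j₁ j₂ | <-cmp j₀ j₂
  ... | tri≈ _ refl _ | _             | _             = ⊥-elim (n₀ refl)
  ... | _             | tri≈ _ refl _ | _             = ⊥-elim (n₁ refl)
  ... | _             | _             | tri≈ _ refl _ = ⊥-elim (n₂ refl)
  ... | tri< 0<1 _ _  | tri< 1<2 _ _  | _             = ascending-rotation⇒nonWL i< 0<1 1<2 ro
  ... | tri< _ _ _    | tri> _ _ 2<1  | tri< 0<2 _ _  = descending-rotation⇒nonWL i< 0<2 2<1 ro
  ... | tri< 0<1 _ _  | tri> _ _ _    | tri> _ _ 2<0  =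
    ascending-rotation⇒nonWL i< 2<0 0<1 (rotate (rotate ro))
  ... | tri> _ _ 1<0  | tri< _ _ _    | tri< 0<2 _ _  =
    descending-rotation⇒nonWL i< 1<0 0<2 (rotate ro)
  ... | tri> _ _ _    | tri< 1<2 _ _  | tri> _ _ 2<0  =
    ascending-rotation⇒nonWL i< 1<2 2<0 (rotate ro)
  ... | tri> _ _ 1<0  | tri> _ _ 2<1  | _             =
    descending-rotation⇒nonWL i< 2<1 1<0 (rotate (rotate ro))

  rotation⇒nonWL : Rotation M → HasNonWLSubmatrix M 2 3
  rotation⇒nonWL (i , i′ , j₀ , j₁ , j₂ , ro@(e₀ , _ , _ , n₀ , _)) with <-cmp i i′
  ... | tri< i< _ _   = row-sorted-rotation⇒nonWL i< ro
  ... | tri≈ _ refl _ = ⊥-elim (n₀ e₀)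
  ... | tri> _ _ i>   = row-sorted-rotation⇒nonWL i> (reflect ro)

  exchange? : Dec (Exchange M)
  exchange? = any? λ i → any? λ i′ → any? λ j → any? λ j′ →
    (M i j ≟ M i′ j′) ×-dec (M i j′ ≟ M i′ j) ×-dec ¬? (M i j ≟ M i j′)

  rotation? : Dec (Rotation M)
  rotation? = any? λ i → any? λ i′ → any? λ j₀ → any? λ j₁ → any? λ j₂ →
    (M i′ j₀ ≟ M i j₁) ×-dec (M i′ j₁ ≟ M i j₂) ×-dec (M i′ j₂ ≟ M i j₀) ×-dec
    ¬? (M i j₀ ≟ M i j₁) ×-dec ¬? (M i j₁ ≟ M i j₂) ×-dec ¬? (M i j₂ ≟ M i j₀)

exchange-transpose : ∀ {M : Matrix q m n} → Exchange (flip M) → Exchange M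
exchange-transpose (j , j′ , i , i′ , e , e′ , ne) =
  i , i′ , j , j′ , e , sym e′ , λ eq → ne (trans eq (sym e′))

-- The exchange pattern is its own transpose, so only rotations are listed for `flip M` as well.
Obstruction : Matrix q m n → Set
Obstruction M = Exchange M ⊎ Rotation M ⊎ Rotation (flip M)

-- This finite search justifies the argument by contradiction in `closedWalk⇒obstruction`.
obstruction? : (M : Matrix q m n) → Dec (Obstruction M)
obstruction? M = exchange? M ⊎-dec rotation? M ⊎-dec rotation? (flip M)

obstruction-transpose : ∀ {M : Matrix q m n} → Obstruction (flip M) → Obstruction M
obstruction-transpose = Sum.map exchange-transpose Sum.swap

obstruction⇒nonWL : (M : Matrix q m n) → Obstruction M →
  HasNonWLSubmatrix M 2 2 ⊎ HasNonWLSubmatrix M 2 3 ⊎ HasNonWLSubmatrix M 3 2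
obstruction⇒nonWL M =
  Sum.map (exchange⇒nonWL M)
    (Sum.map (rotation⇒nonWL M) (HasNonWLSubmatrix-transpose {M = M} ∘ rotation⇒nonWL (flip M)))

-- Two-coloured closed walks

parity : ∀ n → ∃ λ k → n ≡ k * 2 ⊎ n ≡ suc (k * 2)
parity zero    = 0 , inj₁ refl
parity (suc n) with parity n
... | k , inj₁ refl = k , inj₂ refl
... | k , inj₂ refl = suc k , inj₁ refl

suc-% : ∀ m n .{{_ : NonZero n}} →
        suc m % n ≡ suc (m % n) ⊎ (suc (m % n) ≡ n × suc m % n ≡ 0)
suc-% m n = Sum.map
  (λ 1+r<n → trans suc-%-% (m<n⇒m%n≡m 1+r<n))
  (λ 1+r≡n → 1+r≡n , trans suc-%-% (trans (cong (_% n) 1+r≡n) (n%n≡0 n)))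
  (m≤n⇒m<n∨m≡n (m%n<n m n))
  where
  suc-%-% : suc m % n ≡ suc (m % n) % n
  suc-%-% = trans (%-distribˡ-+ 1 m n)
    (trans (cong (λ r → (1 % n + r) % n) (sym (m%n%n≡m%n m n))) (sym (%-distribˡ-+ 1 (m % n) n)))

-- Positions may repeat, and periodicity of the columns alone suffices.
record ClosedWalk (M : Matrix q m n) (a b : Fin q) (k : ℕ) : Set where
  field
    r : ℕ → Fin m
    c : ℕ → Fin n
    isA : ∀ i → M (r i) (c i) ≡ a
    isB : ∀ i → M (r i) (c (suc i)) ≡ b
    c-periodic : ∀ i → c (k + i) ≡ c i

-- Reducing indices modulo `suc l` repeats a finite segment for ever; `c-closed` enters exactly
-- where the index wraps around.
close : ∀ {M : Matrix q m n} {a b} l (r : ℕ → Fin m) (c : ℕ → Fin n) →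
  (∀ i → i < suc l → M (r i) (c i) ≡ a) → (∀ i → i < suc l → M (r i) (c (suc i)) ≡ b) →
  c (suc l) ≡ c 0 → ClosedWalk M a b (suc l)
close {M = M} l r c isA isB c-closed = record
  { r = λ i → r (i % suc l)
  ; c = λ i → c (i % suc l)
  ; isA = λ i → isA _ (m%n<n i (suc l))
  ; isB = λ i → trans (cong (M _) (c-suc i)) (isB _ (m%n<n i (suc l)))
  ; c-periodic = λ i → cong c (periodic i)
  }
  where
  periodic : ∀ i → (suc l + i) % suc l ≡ i % suc l
  periodic i = trans (cong (_% suc l) (+-comm (suc l) i)) ([m+n]%n≡m%n i (suc l))

  c-suc : ∀ i → c (suc i % suc l) ≡ c (suc (i % suc l))
  c-suc i with suc-% i (suc l)
  ... | inj₁ eq        = cong c eq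
  ... | inj₂ (eq , e₀) = trans (cong c e₀) (trans (sym c-closed) (cong c (sym eq)))

-- If `u` and `v` differed, `a`, `b`, `u`, `v`, `w` would be five distinct elements of `Fin 4`. The
-- bound of four colours enters here.
colours-exhausted : ∀ {a b u v w : Fin 4} → a ≢ b →
  u ≢ a → u ≢ b → v ≢ a → v ≢ b → w ≢ a → w ≢ b → u ≢ w → v ≢ w → u ≡ v
colours-exhausted {a} {b} {u} {v} {w} a≢b u≢a u≢b v≢a v≢b w≢a w≢b u≢w v≢w =
  decidable-stable (u ≟ v) λ u≢v →
    case pigeonhole (n<1+n 4) (Vec.lookup (a ∷ b ∷ u ∷ v ∷ w ∷ [])) of λ where
      (i , j , i<j , eq) → Fin.<⇒≢ i<j (lookup-injective
        ( (a≢b ∷ ≢-sym u≢a ∷ ≢-sym v≢a ∷ ≢-sym w≢a ∷ [])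
        ∷ (≢-sym u≢b ∷ ≢-sym v≢b ∷ ≢-sym w≢b ∷ [])
        ∷ (u≢v ∷ u≢w ∷ []) ∷ (v≢w ∷ []) ∷ [] ∷ []) i j eq)

-- Closed walks of least period

module _ {M : Matrix 4 m n} {a b : Fin 4} (a≢b : a ≢ b) (unobstructed : ¬ Obstruction M) where

  module _ {k} (W : ClosedWalk M a b k) where
    open ClosedWalk W

    -- Row `ρ` leads from column `c (d + p)` straight back to `c p`; the `d` rows from `r p` on
    -- return to `c (d + p)`.
    shortcut : ∀ {ρ} d p → M ρ (c (d + p)) ≡ a → M ρ (c p) ≡ b → ClosedWalk M a b (suc d)
    shortcut {ρ} d p ρ-a ρ-b = close d r′ c′ isA′ isB′ refl
      where
      r′ : ℕ → Fin m
      r′ zero    = ρ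
      r′ (suc t) = r (t + p)
      c′ : ℕ → Fin n
      c′ zero    = c (d + p)
      c′ (suc t) = c (t + p)
      isA′ : ∀ i → i < suc d → M (r′ i) (c′ i) ≡ a
      isA′ zero    _ = ρ-a
      isA′ (suc t) _ = isA (t + p)
      isB′ : ∀ i → i < suc d → M (r′ i) (c′ (suc i)) ≡ b
      isB′ zero    _ = ρ-b
      isB′ (suc t) _ = isB (t + p)

  ¬walk₁ : ¬ ClosedWalk M a b 1
  ¬walk₁ W = a≢b (trans (sym (isA 0)) (trans (cong (M (r 0)) (sym (c-periodic 0))) (isB 0)))
    where open ClosedWalk W

  ¬walk₂ : ¬ ClosedWalk M a b 2
  ¬walk₂ W = unobstructed (inj₁ (r 0 , r 1 , c 0 , c 1 ,
    trans (isA 0) (sym (isA 1)) ,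
    trans (isB 0) (trans (sym (isB 1)) (cong (M (r 1)) (c-periodic 0))) ,
    λ eq → a≢b (trans (sym (isA 0)) (trans eq (isB 0)))))
    where open ClosedWalk W

  module _ {h} (W : ClosedWalk M a b (3 + h))
    (minimal : ∀ {d} → d < 2 + h → ¬ ClosedWalk M a b (suc d)) where
    open ClosedWalk W

    -- For f ≤ h these are the entries of row r i in the columns of the walk other than c i and
    -- c (suc i); by minimality they avoid a and b.
    T : ℕ → ℕ → Fin 4
    T f i = M (r i) (c (2 + f + i))

    -- With the `b` at `(r i , c (suc i))`, such an `a` would close up the stretch from `c (suc i)`
    -- to `c (2 + f + i)`, giving period `2 + f`.
    T≢a : ∀ f i → f ≤ h → T f i ≢ a
    T≢a f i f≤h T≡a = minimal (s≤s (s≤s f≤h)) (shortcut W (suc f) (suc i)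
      (trans (cong (λ x → M (r i) (c (suc x))) (+-suc f i)) T≡a) (isB i))

    -- Here the stretch runs the other way round, from `c (2 + f + i)` on to `c (3 + h + i)`, which
    -- is `c i` and meets the `a` of row `r i`.
    T≢b : ∀ f i → f ≤ h → T f i ≢ b
    T≢b f i f≤h T≡b with m≤n⇒∃[o]m+o≡n f≤h
    ... | g , refl = minimal (s≤s (s≤s (m≤n+m g f))) (shortcut W (suc g) (2 + f + i)
      (trans (cong (M (r i)) (trans (cong c (eq f g i)) (c-periodic i))) (isA i)) T≡b)
      where
      eq : ∀ f g i → suc g + (2 + f + i) ≡ 3 + (f + g) + i
      eq = solve-∀

    T-two-valued : ∀ {f f′ f″ i i′ i″} → f ≤ h → f′ ≤ h → f″ ≤ h →
                   T f i ≢ T f″ i″ → T f′ i′ ≢ T f″ i″ → T f i ≡ T f′ i′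
    T-two-valued {f} {f′} {f″} {i} {i′} {i″} p p′ p″ =
      colours-exhausted a≢b (T≢a f i p) (T≢b f i p) (T≢a f′ i′ p′) (T≢b f′ i′ p′) (T≢a f″ i″ p″) (T≢b f″ i″ p″)

    -- The last entry T h (suc i) wraps around to the column just left of the a-entry in row suc i.
    below-diagonal : ∀ i → T h (suc i) ≡ M (r (suc i)) (c i)
    below-diagonal i = cong (M _) (trans (cong c (cong (2 +_) (+-suc h i))) (c-periodic i))

    -- Put `j = 2 + f + i`. By periodicity the entries are those at `(r i , c j)` and `(r j , c i)`;
    -- if equal, they form an exchange with the `a` at `(r i , c i)` and `(r j , c j)`.
    exchange-with-a : ∀ f f′ i → suc (f + f′) ≡ h → T f i ≢ T f′ (2 + f + i)
    exchange-with-a f f′ i refl eq = unobstructed (inj₁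
      (r i , r (2 + f + i) , c i , c (2 + f + i) ,
       trans (isA _) (sym (isA _)) ,
       trans eq (cong (M _) (trans (cong c (index f f′ i)) (c-periodic i))) ,
       λ a≡T → T≢a f i (m≤n⇒m≤1+n (m≤m+n f f′)) (trans (sym a≡T) (isA i))))
      where
      index : ∀ f f′ i → 2 + f′ + (2 + f + i) ≡ 3 + suc (f + f′) + i
      index = solve-∀

    -- The analogue for the `b` in rows `r i` and `r j`, which lie in columns `c (suc i)` and
    -- `c (suc j)`.
    exchange-with-b : ∀ f f′ i → f + f′ ≡ h → T (suc f) i ≢ T f′ (2 + f + i)
    exchange-with-b f f′ i refl eq = unobstructed (inj₁
      (r i , r (2 + f + i) , c (suc i) , c (3 + f + i) ,
       trans (isB i) (sym (isB _)) ,
       trans eq T≡ ,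
       λ b≡T → T≢b f′ (2 + f + i) (m≤n+m f′ f) (trans (sym eq) (trans (sym b≡T) (isB i)))))
      where
      index : ∀ f f′ i → 2 + f′ + (2 + f + i) ≡ 3 + (f + f′) + suc i
      index = solve-∀

      T≡ : T f′ (2 + f + i) ≡ M (r (2 + f + i)) (c (suc i))
      T≡ = cong (M _) (trans (cong c (index f f′ i)) (c-periodic (suc i)))

    -- If both were `x`, the arrows from row `r i` to row `r (suc i)` would run from `a` to `x`, `x`
    -- to `b` and `b` to `a`.
    above≢below : ∀ i → T 0 i ≢ T h (suc i)
    above≢below i eq = unobstructed (inj₂ (inj₁
      (r i , r (suc i) , c i , c (2 + i) , c (suc i) ,
       trans (sym (below-diagonal i)) (sym eq) ,
       trans (isB (suc i)) (sym (isB i)) ,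
       trans (isA (suc i)) (sym (isA i)) ,
       (λ e → T≢a 0 i z≤n (trans (sym e) (isA i))) ,
       (λ e → T≢b 0 i z≤n (trans e (isB i))) ,
       λ e → a≢b (trans (sym (isA i)) (trans (sym e) (isB i))))))

    -- If both were `x`, the arrows from column `c (suc i)` to column `c (2 + i)` would run from `b`
    -- to `x`, `x` to `a` and `a` to `b`.
    above≢next-below : ∀ i → T 0 i ≢ T h (2 + i)
    above≢next-below i eq = unobstructed (inj₂ (inj₂
      (c (suc i) , c (2 + i) , r i , r (2 + i) , r (suc i) ,
       trans eq (below-diagonal (suc i)) ,
       trans (isA (2 + i)) (sym (isA (suc i))) ,
       trans (isB (suc i)) (sym (isB i)) ,
       (λ e → T≢b h (2 + i) ≤-refl (trans (below-diagonal (suc i)) (trans (sym e) (isB i)))) ,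
       (λ e → T≢a h (2 + i) ≤-refl (trans (below-diagonal (suc i)) (trans e (isA (suc i))))) ,
       λ e → a≢b (trans (sym (isA (suc i))) (trans e (isB i))))))

    -- Both entries differ from `T h (2 + i)`, and only two colours are available.
    T₀-constant : ∀ i → T 0 i ≡ T 0 (suc i)
    T₀-constant i =
      T-two-valued z≤n z≤n ≤-refl (above≢next-below i) (above≢below (suc i))

    -- Both entries differ from the one at `(r (3 + f + i) , c (suc i))`, which by periodicity is
    -- `T f′ (3 + f + i)`.
    slide : ∀ f i → 2 + f ≤ h → T (2 + f) i ≡ T f (suc i)
    slide f i 2+f≤h with m≤n⇒∃[o]m+o≡n (<⇒≤ 2+f≤h)
    ... | f′ , eq = T-two-valued 2+f≤h (≤-trans (m≤n+m f 2) 2+f≤h)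
      (≤-trans (m≤n+m f′ (suc f)) (≤-reflexive eq))
      (exchange-with-b (suc f) f′ i eq)
      (subst (λ x → T f (suc i) ≢ T f′ (2 + x)) (+-suc f i) (exchange-with-a f f′ (suc i) eq))

    T-even : ∀ e i → e * 2 ≤ h → T (e * 2) i ≡ T 0 i
    T-even zero    i _     = refl
    T-even (suc e) i 2e≤h = trans (slide (e * 2) i 2e≤h)
      (trans (T-even e (suc i) (≤-trans (m≤n+m (e * 2) 2) 2e≤h)) (sym (T₀-constant i)))

    minimal-walk-impossible : ⊥
    minimal-walk-impossible with parity h
    -- The period `3 + h` is odd, and the entry at distance `2 + h` slides down to distance 2.
    ... | e , inj₁ refl = above≢below 0 (trans (T₀-constant 0) (sym (T-even e 1 ≤-refl)))
    -- The period is even. The entry at distance `1 + h` in row `r 2` lies in column `c 0`; sliding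
    -- makes it equal to its mirror image at `(r 0 , c 2)`.
    ... | e , inj₂ refl = exchange-with-a 0 (e * 2) 0 refl
      (trans (T₀-constant 0) (trans (T₀-constant 1) (sym (T-even e 2 (m≤n+m (e * 2) 1)))))

  -- In a strong induction on the period, the induction hypothesis is the required minimality.
  ¬walk : ∀ l → ¬ ClosedWalk M a b (suc l)
  ¬walk = <-rec (λ l → ¬ ClosedWalk M a b (suc l)) λ where
    0             _       W → ¬walk₁ W
    1             _       W → ¬walk₂ W
    (suc (suc h)) minimal W → minimal-walk-impossible W minimal

closedWalk⇒obstruction : ∀ (M : Matrix 4 m n) {a b l} →
  a ≢ b → ClosedWalk M a b (suc l) → Obstruction M
closedWalk⇒obstruction M {l = l} a≢b W =
  decidable-stable (obstruction? M) λ unobstructed → ¬walk a≢b unobstructed l W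

-- Cycles

SharesLine : Pos m n → Pos m n → Set
SharesLine p p′ = row p ≡ row p′ ⊎ col p ≡ col p′

NotInRow : Pos m n → Pos m n → Pos m n → Set
NotInRow p p′ p″ = ¬ (row p ≡ row p′ × row p′ ≡ row p″)

NotInCol : Pos m n → Pos m n → Pos m n → Set
NotInCol p p′ p″ = ¬ (col p ≡ col p′ × col p′ ≡ col p″)

module _ {M : Matrix q m n} {a b : Fin q} (u : ℕ → Pos m n) (k : ℕ)
  (adjacent : ∀ l → l < suc (suc k * 2) → SharesLine (u l) (u (suc l)))
  (¬rows : ∀ l → l < suc k * 2 → NotInRow (u l) (u (suc l)) (u (2 + l)))
  (¬cols : ∀ l → l < suc k * 2 → NotInCol (u l) (u (suc l)) (u (2 + l)))
  (even-a : ∀ i → i < suc k → M (row (u (i * 2))) (col (u (i * 2))) ≡ a)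
  (odd-b : ∀ i → i < suc k → M (row (u (suc (i * 2)))) (col (u (suc (i * 2)))) ≡ b)
  (closed : u (suc k * 2) ≡ u 0)
  (first-row : row (u 0) ≡ row (u 1)) where

  row⇒col : ∀ l → l < suc k * 2 → row (u l) ≡ row (u (suc l)) → col (u (suc l)) ≡ col (u (2 + l))
  row⇒col l l<K same-row =
    [ (λ e → ⊥-elim (¬rows l l<K (same-row , e))) , (λ e → e) ]′ (adjacent (suc l) (s≤s l<K))

  col⇒row : ∀ l → l < suc k * 2 → col (u l) ≡ col (u (suc l)) → row (u (suc l)) ≡ row (u (2 + l))
  col⇒row l l<K same-col =
    [ (λ e → e) , (λ e → ⊥-elim (¬cols l l<K (same-col , e))) ]′ (adjacent (suc l) (s≤s l<K))

  1+2i<K : ∀ {i} → i < suc k → suc (i * 2) < suc k * 2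
  1+2i<K i<k = *-monoˡ-≤ 2 i<k

  -- The turning conditions force row steps and column steps to alternate, so the two claims are
  -- proved by mutual induction from `first-row`.
  row-step : ∀ i → i < suc k → row (u (i * 2)) ≡ row (u (suc (i * 2)))
  col-step : ∀ i → i < suc k → col (u (suc (i * 2))) ≡ col (u (suc i * 2))
  row-step zero    _     = first-row
  row-step (suc i) 1+i<k =
    col⇒row (suc (i * 2)) (1+2i<K (<⇒≤ 1+i<k)) (col-step i (<⇒≤ 1+i<k))
  col-step i i<k = row⇒col (i * 2) (<⇒≤ (1+2i<K i<k)) (row-step i i<k)

  alternating-cycle⇒closedWalk : ClosedWalk M a b (suc k)
  alternating-cycle⇒closedWalk = close k (λ i → row (u (i * 2))) (λ i → col (u (i * 2))) even-a
    (λ i i<k → trans (cong₂ M (row-step i i<k) (sym (col-step i i<k))) (odd-b i i<k))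
    (cong col closed)

PathConds-values : ∀ {M : Matrix q m n} {K u} → PathConds M K u →
  ∃ λ a → ∃ λ b → a ≢ b ×
    (∀ i → i * 2 < K → M (row (u (i * 2))) (col (u (i * 2))) ≡ a) ×
    (∀ i → suc (i * 2) < K → M (row (u (suc (i * 2)))) (col (u (suc (i * 2)))) ≡ b)
PathConds-values {M = M} {K} {u} (_ , _ , a , b , a≢b , values) = a , b , a≢b , even , odd
  where
  even : ∀ i → i * 2 < K → M (row (u (i * 2))) (col (u (i * 2))) ≡ a
  even i 2i<K with values (i * 2) 2i<K
  ... | e rewrite m*n%n≡0 i 2 {{_}} = e

  odd : ∀ i → suc (i * 2) < K → M (row (u (suc (i * 2)))) (col (u (suc (i * 2)))) ≡ b
  odd i 1+2i<K with values (suc (i * 2)) 1+2i<K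
  ... | e rewrite [m+kn]%n≡m%n 1 i 2 {{_}} = e

cycle⇒obstruction : ∀ (M : Matrix 4 m n) k s → Cycle M (suc k) s → Obstruction M
cycle⇒obstruction {m} {n} M k s (_ , conds@(adjacent , turning , _))
  with PathConds-values {M = M} {u = cyc (suc k) s} conds
... | a , b , a≢b , even-a , odd-b = case parity (suc k) of λ where
    (zero  , inj₁ ())
    -- In a cycle of odd length, the first entry recurs at an odd index and would be both `a` and
    -- `b`.
    (h     , inj₂ eq) → ⊥-elim (a≢b (trans (sym (even-a 0 z<s)) (trans
      (sym (cong (λ p → M (row p) (col p)) (trans (cong u (sym eq)) closed)))
      (odd-b h (subst (_< suc k + 2) eq (<K+2 (n≤1+n k)))))))
    (suc h , inj₁ eq) →
      [ obstruction-from-row h eq , obstruction-from-col h eq ]′ (adjacent 0 (<K+2 z≤n))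
  where
  u : ℕ → Pos m n
  u = cyc (suc k) s

  closed : u (suc k) ≡ u 0
  closed = cong s (n%n≡0 (suc k))

  <K+2 : ∀ {l} → l ≤ suc k → suc l < suc k + 2
  <K+2 l≤K = ≤-trans (s≤s (s≤s l≤K)) (≤-reflexive (+-comm 2 (suc k)))

  module _ (h : ℕ) (eq : suc k ≡ suc h * 2) where
    ≤K : ∀ {l} → l ≤ suc h * 2 → l ≤ suc k
    ≤K l≤ = ≤-trans l≤ (≤-reflexive (sym eq))

    adjacent′ : ∀ l → l < suc (suc h * 2) → SharesLine (u l) (u (suc l))
    adjacent′ l (s≤s l≤) = adjacent l (<K+2 (≤K l≤))

    turning′ : ∀ l → l < suc h * 2 →
               NotInRow (u l) (u (suc l)) (u (2 + l)) × NotInCol (u l) (u (suc l)) (u (2 + l))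
    turning′ l l< = turning l (<K+2 (≤K l<))

    even-a′ : ∀ i → i < suc h → M (row (u (i * 2))) (col (u (i * 2))) ≡ a
    even-a′ i i<h = even-a i (<⇒≤ (<K+2 (≤K (<⇒≤ (<⇒≤ (*-monoˡ-≤ 2 i<h))))))

    odd-b′ : ∀ i → i < suc h → M (row (u (suc (i * 2)))) (col (u (suc (i * 2)))) ≡ b
    odd-b′ i i<h = odd-b i (<K+2 (≤K (<⇒≤ (<⇒≤ (*-monoˡ-≤ 2 i<h)))))

    closed′ : u (suc h * 2) ≡ u 0
    closed′ = trans (cong u (sym eq)) closed

    obstruction-from-row : row (u 0) ≡ row (u 1) → Obstruction M
    obstruction-from-row same-row = closedWalk⇒obstruction M a≢b
      (alternating-cycle⇒closedWalk {M = M} u h adjacent′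
        (λ l → proj₁ ∘ turning′ l) (λ l → proj₂ ∘ turning′ l) even-a′ odd-b′ closed′ same-row)

    obstruction-from-col : col (u 0) ≡ col (u 1) → Obstruction M
    obstruction-from-col same-col = obstruction-transpose (closedWalk⇒obstruction (flip M) a≢b
      (alternating-cycle⇒closedWalk {M = flip M} (Product.swap ∘ u) h (λ l → Sum.swap ∘ adjacent′ l)
        (λ l → proj₂ ∘ turning′ l) (λ l → proj₁ ∘ turning′ l) even-a′ odd-b′
        (cong Product.swap closed′) same-col))

theorem3p10 : (m n : ℕ) (M : Matrix 4 m n) (K : ℕ) (s : ℕ → Pos m n) →
    6 ≤ K → Cycle M K s →
    HasNonWLSubmatrix M 2 2 ⊎ HasNonWLSubmatrix M 2 3 ⊎ HasNonWLSubmatrix M 3 2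
theorem3p10 m n M (suc k) s _ cycle = obstruction⇒nonWL M (cycle⇒obstruction M k s cycle)
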